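{- Let $Q_5$ be the edge graph of the $5$-dimensional hypercube (vertices $\{0,1\}^5$, two vertices adjacent iff they differ in exactly one coordinate). Up to a permutation of the colours (simultaneous permutation of rows and columns of the colour adjacency matrix), the colour adjacency matrices of perfect $2$-colourings of $Q_5$ are exactly the six matrices \[ \begin{pmatrix} 0 & 5 \\ 5 & 0 \end{pmatrix}, \begin{pmatrix} 1 & 4 \\ 4 & 1 \end{pmatrix}, \begin{pmatrix} 2 & 3 \\ 1 & 4 \end{pmatrix}, \begin{pmatrix} 2 & 3 \\ 3 & 2 \end{pmatrix}, \begin{pmatrix} 3 & 2 \\ 2 & 3 \end{pmatrix}, \begin{pmatrix} 4 & 1 \\ 1 & 4 \end{pmatrix}, \] and the colour adjacency matrices of perfect $3$-colourings of $Q_5$ are exactly the eight matrices \[ \begin{pmatrix} 0 & 1 & 4 \\ 1 & 0 & 4 \\ 2 & 2 & 1 \end{pmatrix}, \begin{pmatrix} 0 & 3 & 2 \\ 3 & 0 & 2 \\ 1 & 1 & 3 \end{pmatrix}, \begin{pmatrix} 0 & 5 & 0 \\ 1 & 0 & 4 \\ 0 & 2 & 3 \end{pmatrix}, \begin{pmatrix} 1 & 0 & 4 \\ 0 & 1 & 4 \\ 1 & 3 & 1 \end{pmatrix}, \begin{pmatrix} 1 & 0 & 4 \\ 0 & 1 & 4 \\ 2 & 2 & 1 \end{pmatrix}, \begin{pmatrix} 1 & 2 & 2 \\ 2 & 1 & 2 \\ 1 & 1 & 3 \end{pmatrix}, \begin{pmatrix} 2 & 1 & 2 \\ 1 & 2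 & 2 \\ 1 & 1 & 3 \end{pmatrix}, \begin{pmatrix} 3 & 0 & 2 \\ 0 & 3 & 2 \\ 1 & 1 & 3 \end{pmatrix}. \] In particular each of these matrices is realized by some perfect colouring of $Q_5$.
   Context: An $m$-colouring of a graph $G=(V,E)$ is a partition of $V$ into $m$ disjoint nonempty sets $V_1,\dots,V_m$ (the colours; adjacent vertices may have the same colour). It is perfect if for all $i,j$ every vertex of colour $i$ has the same number $a_{ij}$ of neighbours of colour $j$; the matrix $A=(a_{ij})$ is its colour adjacency matrix. Relabelling colours by a permutation $\sigma$ replaces $A$ by $(a_{\sigma(i)\sigma(j)})$. -}

module Defs where

open import Data.Bool.Base using (Bool; true; false)
open import Data.Bool.Properties using () renaming (_≟_ to _≟ᵇ_)
open import Data.Empty using (⊥)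
open import Data.Fin.Base using (Fin)
open import Data.Fin.Permutation using (Permutation′; _⟨$⟩ʳ_)
open import Data.Fin.Properties using (any?; all?) renaming (_≟_ to _≟ᶠ_)
open import Data.List.Base using (List; []; _∷_; _++_; map; filter; length)
open import Data.List.Membership.Propositional using (_∈_)
open import Data.List.Membership.Propositional.Properties using (∈-map⁺; ∈-map⁻; ∈-++⁺ˡ; ∈-++⁺ʳ)
open import Data.List.Relation.Unary.All using ([])
open import Data.List.Relation.Unary.AllPairs using ([]; _∷_)
open import Data.List.Relation.Unary.Any using (here)
open import Data.List.Relation.Unary.Unique.Propositional using (Unique)
open import Data.List.Relation.Unary.Unique.Propositional.Properties using (map⁺; ++⁺)
open import Data.Nat.Base using (ℕ; zero; suc)
open import Data.Product using (_×_; _,_; ∃; ∃-syntax; ∃!)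
open import Data.Vec.Base using (Vec; []; _∷_; lookup)
open import Data.Vec.Properties using (∷-injectiveʳ)
open import Function.Base using (_∘_)
open import Function.Definitions using (StrictlySurjective)
open import Relation.Binary.Definitions using (Decidable; Irreflexive; Symmetric)
open import Relation.Binary.PropositionalEquality using (_≡_; _≢_; refl; sym)
open import Relation.Nullary.Decidable using (Dec; map′; ¬?; _×-dec_; _→-dec_)

-- A finite simple graph; the vertex list only serves to count neighbours.

record FiniteGraph : Set₁ where
  field
    Vertex   : Set
    Adj      : Vertex → Vertex → Set
    adj?     : Decidable Adj
    irrefl   : Irreflexive _≡_ Adj
    symm     : Symmetric Adj
    vertices : List Vertex
    unique   : Unique vertices
    complete : ∀ v → v ∈ vertices

-- A partition of the vertices into m nonempty classes V₁, …, Vₘ is given by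
-- the map sending a vertex to the index of its class; the classes are
-- nonempty exactly when this map is surjective.

record Colouring (G : FiniteGraph) (m : ℕ) : Set where
  open FiniteGraph G
  field
    colour   : Vertex → Fin m
    nonempty : StrictlySurjective _≡_ colour

  neighboursOfColour : Vertex → Fin m → ℕ
  neighboursOfColour v j =
    length (filter (λ w → adj? v w ×-dec (colour w ≟ᶠ j)) vertices)

Matrix : ℕ → Set
Matrix m = Vec (Vec ℕ m) m

entry : ∀ {m} → Matrix m → Fin m → Fin m → ℕ
entry A i j = lookup (lookup A i) j

-- The colouring is perfect and A is its colour adjacency matrix (which is
-- unique, as every colour is used).

PerfectWithMatrix : ∀ {G m} → Colouring G m → Matrix m → Set
PerfectWithMatrix {G} c A =
  ∀ i j (v : Vertex) → colour v ≡ i → neighboursOfColour v j ≡ entry A i j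
  where
  open FiniteGraph G
  open Colouring c

IsColourAdjacencyMatrix : ∀ (G : FiniteGraph) {m} → Matrix m → Set
IsColourAdjacencyMatrix G {m} A = ∃[ c ] PerfectWithMatrix {G} {m} c A

infix 4 _∼_

_∼_ : ∀ {m} → Matrix m → Matrix m → Set
_∼_ {m} A B =
  ∃ λ (σ : Permutation′ m) →
    ∀ i j → entry B i j ≡ entry A (σ ⟨$⟩ʳ i) (σ ⟨$⟩ʳ j)

Cube : ℕ → Set
Cube = Vec Bool

CubeAdj : ∀ {n} → Cube n → Cube n → Set
CubeAdj u v = ∃! _≡_ (λ i → lookup u i ≢ lookup v i)

cubeAdj? : ∀ {n} → Decidable (CubeAdj {n})
cubeAdj? u v =
  map′ (λ (i , d , f) → i , d , λ {k} → f k)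
       (λ (i , d , f) → i , d , λ k → f {k})
       (any? λ i → differ? i ×-dec all? λ k → differ? k →-dec (i ≟ᶠ k))
  where
  differ? : ∀ i → Dec (lookup u i ≢ lookup v i)
  differ? i = ¬? (lookup u i ≟ᵇ lookup v i)

cubeVertices : ∀ n → List (Cube n)
cubeVertices zero    = [] ∷ []
cubeVertices (suc n) =
  map (false ∷_) (cubeVertices n) ++ map (true ∷_) (cubeVertices n)

cubeVertices-complete : ∀ {n} (v : Cube n) → v ∈ cubeVertices n
cubeVertices-complete []          = here refl
cubeVertices-complete (false ∷ v) =
  ∈-++⁺ˡ (∈-map⁺ (false ∷_) (cubeVertices-complete v))
cubeVertices-complete (true ∷ v)  =
  ∈-++⁺ʳ (map (false ∷_) (cubeVertices _)) (∈-map⁺ (true ∷_) (cubeVertices-complete v))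

cubeVertices-unique : ∀ n → Unique (cubeVertices n)
cubeVertices-unique zero    = [] ∷ []
cubeVertices-unique (suc n) =
  ++⁺ (map⁺ ∷-injectiveʳ (cubeVertices-unique n))
      (map⁺ ∷-injectiveʳ (cubeVertices-unique n))
      λ (p , q) → disjoint (∈-map⁻ (false ∷_) p) (∈-map⁻ (true ∷_) q)
  where
  disjoint : ∀ {v} → ∃ (λ x → x ∈ cubeVertices n × v ≡ false ∷ x) →
             ∃ (λ y → y ∈ cubeVertices n × v ≡ true ∷ y) → ⊥
  disjoint (_ , _ , refl) (_ , _ , ())

Q : ℕ → FiniteGraph
Q n = record
  { Vertex   = Cube n
  ; Adj      = CubeAdj
  ; adj?     = cubeAdj?
  ; irrefl   = λ { refl (_ , d , _) → d refl }
  ; symm     = λ (i , d , f) → i , d ∘ sym , λ e → f (e ∘ sym)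
  ; vertices = cubeVertices n
  ; unique   = cubeVertices-unique n
  ; complete = cubeVertices-complete
  }

matrices₂ : List (Matrix 2)
matrices₂ =
    ((0 ∷ 5 ∷ []) ∷
     (5 ∷ 0 ∷ []) ∷ [])
  ∷ ((1 ∷ 4 ∷ []) ∷
     (4 ∷ 1 ∷ []) ∷ [])
  ∷ ((2 ∷ 3 ∷ []) ∷
     (1 ∷ 4 ∷ []) ∷ [])
  ∷ ((2 ∷ 3 ∷ []) ∷
     (3 ∷ 2 ∷ []) ∷ [])
  ∷ ((3 ∷ 2 ∷ []) ∷
     (2 ∷ 3 ∷ []) ∷ [])
  ∷ ((4 ∷ 1 ∷ []) ∷
     (1 ∷ 4 ∷ []) ∷ [])
  ∷ []

matrices₃ : List (Matrix 3)
matrices₃ =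
    ((0 ∷ 1 ∷ 4 ∷ []) ∷
     (1 ∷ 0 ∷ 4 ∷ []) ∷
     (2 ∷ 2 ∷ 1 ∷ []) ∷ [])
  ∷ ((0 ∷ 3 ∷ 2 ∷ []) ∷
     (3 ∷ 0 ∷ 2 ∷ []) ∷
     (1 ∷ 1 ∷ 3 ∷ []) ∷ [])
  ∷ ((0 ∷ 5 ∷ 0 ∷ []) ∷
     (1 ∷ 0 ∷ 4 ∷ []) ∷
     (0 ∷ 2 ∷ 3 ∷ []) ∷ [])
  ∷ ((1 ∷ 0 ∷ 4 ∷ []) ∷
     (0 ∷ 1 ∷ 4 ∷ []) ∷
     (1 ∷ 3 ∷ 1 ∷ []) ∷ [])
  ∷ ((1 ∷ 0 ∷ 4 ∷ []) ∷
     (0 ∷ 1 ∷ 4 ∷ []) ∷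
     (2 ∷ 2 ∷ 1 ∷ []) ∷ [])
  ∷ ((1 ∷ 2 ∷ 2 ∷ []) ∷
     (2 ∷ 1 ∷ 2 ∷ []) ∷
     (1 ∷ 1 ∷ 3 ∷ []) ∷ [])
  ∷ ((2 ∷ 1 ∷ 2 ∷ []) ∷
     (1 ∷ 2 ∷ 2 ∷ []) ∷
     (1 ∷ 1 ∷ 3 ∷ []) ∷ [])
  ∷ ((3 ∷ 0 ∷ 2 ∷ []) ∷
     (0 ∷ 3 ∷ 2 ∷ []) ∷
     (1 ∷ 1 ∷ 3 ∷ []) ∷ [])
  ∷ []

{-# OPTIONS --safe #-}

-- Let c be a perfect colouring of Qₙ with matrix A.  The number of vertices of
-- colour j at distance k from v depends only on the colour of v, and these numbers
-- form matrices D₀ = I, D₁ = A, D₂, … that satisfy the Krawtchouk recurrence  A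
-- Dₖ₊₁ = (k+2) Dₖ₊₂ + (n-k) Dₖ.  So all the divisions in this recurrence must come
-- out exactly in ℕ, and A has row sums n.  Moreover ∑ₖ Dₖ has in every row the
-- sizes of the colour classes, which are positive, and counting the edges between
-- two classes from either end relates these sizes to A.  For three colours, these
-- conditions leave exactly the listed matrices.  For two colours, only (0 5; 3 2)
-- has to be excluded in addition: if A i i = 0 and v, w are adjacent of colour j,
-- then the translates of the edge vw in the n-1 other directions meet colour i at
-- most once each, so that 2 A j i ≤ n-1. The colourings that realise the listed
-- matrices compare values of linear functions on 𝔽₂⁵, except for one by the
-- distance to an antipodal pair.
module Submission where

open import Defs
open import Data.Bool.Base using (Bool; true; false; not; _∨_; _xor_; if_then_else_)
open import Data.Bool.Properties using (not-¬; ¬-not; not-involutive) renaming (_≟_ to _≟ᵇ_)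
open import Data.Empty using (⊥-elim)
open import Data.Fin.Base using (Fin; zero; suc; toℕ; punchIn)
open import Data.Fin.Patterns using (0F; 1F; 2F)
open import Data.Fin.Permutation as Perm
  using (Permutation′; _⟨$⟩ʳ_; _⟨$⟩ˡ_; insert; remove; _≈_)
open import Data.Fin.Properties using (all?; suc-injective) renaming (_≟_ to _≟ᶠ_)
open import Data.List.Base
  using (List; []; _∷_; [_]; _++_; map; cartesianProductWith; allFin; filter; upTo; length)
open import Data.List.Membership.Propositional using (_∈_)
open import Data.List.Membership.Propositional.Properties
  using (∈-cartesianProductWith⁺; ∈-allFin; ∈-filter⁺; ∈-upTo⁺)
open import Data.List.Properties using (filter-≐; filter-++; length-++)
open import Data.List.Relation.Unary.All as All using (All; []; _∷_)
open import Data.List.Relation.Unary.AllPairs as AllPairs using (AllPairs)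
open import Data.List.Relation.Unary.Any as Any using (Any; here)
open import Data.List.Relation.Unary.Any.Properties using (cartesianProductWith⁺)
open import Data.Nat.Base hiding (_/_)
open import Data.Nat.DivMod using (_/_; m*n/n≡m)
open import Data.Nat.Properties hiding (suc-injective)
open import Data.Nat.Tactic.RingSolver using (solve-∀)
open import Data.Product using (_×_; _,_; ∃; proj₁; proj₂)
open import Data.Vec.Base using (Vec; []; _∷_; lookup; tabulate; count)
open import Data.Vec.Properties
  using (≡-dec; ∷-injectiveˡ; ∷-injectiveʳ; lookup∘tabulate; tabulate∘lookup; tabulate-cong)
open import Function.Base using (_∘_)
open import Function.Bundles using (_⇔_; mk⇔; module Equivalence)
open import Relation.Binary.PropositionalEquality
  using (_≡_; _≢_; refl; sym; trans; cong; cong₂; subst; module ≡-Reasoning)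
open import Relation.Nullary using (¬_)
open import Relation.Nullary.Decidable
  using (Dec; does; yes; no; map′; ¬?; _×-dec_; _→-dec_; does-⇔; dec-true; dec-false)
open import Relation.Unary using (Decidable)

open import Algebra.Properties.Semiring.Sum +-*-semiring
  using (sum; sum-cong-≗; sum-replicate-zero; ∑-distrib-+)

open Equivalence using (to; from)

private variable
  m n : ℕ

-- Sums over spheres of the cube

-- The sum of `f` over the vertices at Hamming distance `k` from `v`: the first coordinate is kept
-- or flipped, and a flip uses up one unit of distance.
sphereSum : ℕ → (Cube n → ℕ) → Cube n → ℕ
sphereSum zero    f v       = f v
sphereSum (suc k) f []      = 0
sphereSum (suc k) f (b ∷ v) =
  sphereSum (suc k) (f ∘ (b ∷_)) v + sphereSum k (f ∘ (not b ∷_)) v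

cubeSum : (Cube n → ℕ) → ℕ
cubeSum {zero}  f = f []
cubeSum {suc n} f = cubeSum (f ∘ (false ∷_)) + cubeSum (f ∘ (true ∷_))

sphereSum-cong : ∀ k {f g : Cube n → ℕ} → (∀ v → f v ≡ g v) →
                 ∀ v → sphereSum k f v ≡ sphereSum k g v
sphereSum-cong zero    f≗g v       = f≗g v
sphereSum-cong (suc k) f≗g []      = refl
sphereSum-cong (suc k) f≗g (b ∷ v) =
  cong₂ _+_ (sphereSum-cong (suc k) (f≗g ∘ (b ∷_)) v)
            (sphereSum-cong k (f≗g ∘ (not b ∷_)) v)

+-interchange : ∀ a b c d → a + b + (c + d) ≡ a + c + (b + d)
+-interchange = solve-∀

sphereSum-+ : ∀ k (f g : Cube n → ℕ) v →
              sphereSum k (λ w → f w + g w) v ≡ sphereSum k f v + sphereSum k g v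
sphereSum-+ zero    f g v       = refl
sphereSum-+ (suc k) f g []      = refl
sphereSum-+ (suc k) f g (b ∷ v) = trans
  (cong₂ _+_ (sphereSum-+ (suc k) (f ∘ (b ∷_)) (g ∘ (b ∷_)) v)
             (sphereSum-+ k (f ∘ (not b ∷_)) (g ∘ (not b ∷_)) v))
  (+-interchange (sphereSum (suc k) (f ∘ (b ∷_)) v) _ _ _)

sphereSum-∑ : ∀ k (h : Fin m → Cube n → ℕ) v →
              sphereSum k (λ w → sum λ l → h l w) v ≡ sum λ l → sphereSum k (h l) v
sphereSum-∑ {m = zero}  zero    h v       = refl
sphereSum-∑ {m = zero}  (suc k) h []      = refl
sphereSum-∑ {m = zero}  (suc k) h (b ∷ v) =
  cong₂ _+_ (sphereSum-∑ (suc k) (λ l → h l ∘ (b ∷_)) v)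
            (sphereSum-∑ k (λ l → h l ∘ (not b ∷_)) v)
sphereSum-∑ {m = suc m} k       h v       = trans
  (sphereSum-+ k (h zero) _ v)
  (cong (sphereSum k (h zero) v +_) (sphereSum-∑ k (h ∘ suc) v))

sphereSum-* : ∀ k (f : Cube n → ℕ) c v →
              sphereSum k (λ w → f w * c) v ≡ sphereSum k f v * c
sphereSum-* zero    f c v       = refl
sphereSum-* (suc k) f c []      = refl
sphereSum-* (suc k) f c (b ∷ v) = trans
  (cong₂ _+_ (sphereSum-* (suc k) (f ∘ (b ∷_)) c v) (sphereSum-* k (f ∘ (not b ∷_)) c v))
  (sym (*-distribʳ-+ c (sphereSum (suc k) (f ∘ (b ∷_)) v) _))

sphereSum-one : ∀ (v : Cube n) → sphereSum 1 (λ _ → 1) v ≡ n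
sphereSum-one []      = refl
sphereSum-one (b ∷ v) = trans (cong (_+ 1) (sphereSum-one v)) (+-comm _ 1)

-- The Krawtchouk recurrence  S₁ Sₖ₊₁ = (k+2) Sₖ₊₂ + (n-k) Sₖ,  with  k Sₖ  moved to
-- the left so that it holds in ℕ for all k.
sphereSum-recurrence : ∀ k (f : Cube n → ℕ) v →
  sphereSum 1 (sphereSum (suc k) f) v + suc k * sphereSum k f v ≡
  suc (suc k) * sphereSum (suc (suc k)) f v + suc n * sphereSum k f v
sphereSum-recurrence zero    f []      = refl
sphereSum-recurrence (suc k) f []      =
  trans (*-zeroʳ (suc (suc k))) (sym (cong (_+ 0) (*-zeroʳ (suc (suc (suc k))))))
sphereSum-recurrence {suc n} zero f (b ∷ v)
  rewrite not-involutive b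
        | sphereSum-+ 1 (sphereSum 1 (f ∘ (b ∷_))) (f ∘ (not b ∷_)) v
  = combine (sphereSum 1 (sphereSum 1 (f ∘ (b ∷_))) v) (sphereSum 2 (f ∘ (b ∷_)) v)
            (f (b ∷ v)) (sphereSum 1 (f ∘ (not b ∷_)) v)
            (sphereSum-recurrence zero (f ∘ (b ∷_)) v)
  where
  open ≡-Reasoning
  combine : ∀ x y p q → x + 1 * p ≡ 2 * y + suc n * p →
            (x + q) + (q + p) + 1 * p ≡ 2 * (y + q) + suc (suc n) * p
  combine x y p q e = begin
    (x + q) + (q + p) + 1 * p         ≡⟨ lhs x p q ⟩
    (x + 1 * p) + (2 * q + p)         ≡⟨ cong (_+ (2 * q + p)) e ⟩
    (2 * y + suc n * p) + (2 * q + p) ≡⟨ rhs n y p q ⟩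
    2 * (y + q) + suc (suc n) * p     ∎
    where
    lhs : ∀ x p q → (x + q) + (q + p) + 1 * p ≡ (x + 1 * p) + (2 * q + p)
    lhs = solve-∀
    rhs : ∀ n y p q → (2 * y + suc n * p) + (2 * q + p) ≡ 2 * (y + q) + suc (suc n) * p
    rhs = solve-∀
sphereSum-recurrence {suc n} (suc k) f (b ∷ v)
  rewrite not-involutive b
        | sphereSum-+ 1 (sphereSum (suc (suc k)) (f ∘ (b ∷_)))
                        (sphereSum (suc k) (f ∘ (not b ∷_))) v
  -- The half of the cube through `b ∷ v` contributes the recurrence at `suc k`, the opposite half
  -- the recurrence at `k`. The terms `y′ + p + p′` left over account for the raised dimension and
  -- for the lower index on the opposite half.
  = combine (sphereSum 1 (sphereSum (suc (suc k)) (f ∘ (b ∷_))) v)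
            (sphereSum (suc k) (f ∘ (b ∷_)) v) (sphereSum (suc (suc (suc k))) (f ∘ (b ∷_)) v)
            (sphereSum 1 (sphereSum (suc k) (f ∘ (not b ∷_))) v)
            (sphereSum k (f ∘ (not b ∷_)) v) (sphereSum (suc (suc k)) (f ∘ (not b ∷_)) v)
            (sphereSum-recurrence (suc k) (f ∘ (b ∷_)) v)
            (sphereSum-recurrence k (f ∘ (not b ∷_)) v)
  where
  open ≡-Reasoning
  combine : ∀ x p y x′ p′ y′ →
            x + suc (suc k) * p ≡ suc (suc (suc k)) * y + suc n * p →
            x′ + suc k * p′ ≡ suc (suc k) * y′ + suc n * p′ →
            (x + x′) + (y′ + p) + suc (suc k) * (p + p′) ≡
            suc (suc (suc k)) * (y + y′) + suc (suc n) * (p + p′)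
  combine x p y x′ p′ y′ e e′ = begin
    (x + x′) + (y′ + p) + suc (suc k) * (p + p′)
      ≡⟨ lhs k x p x′ p′ y′ ⟩
    (x + suc (suc k) * p) + (x′ + suc k * p′) + (y′ + p + p′)
      ≡⟨ cong (_+ (y′ + p + p′)) (cong₂ _+_ e e′) ⟩
    (suc (suc (suc k)) * y + suc n * p) + (suc (suc k) * y′ + suc n * p′) + (y′ + p + p′)
      ≡⟨ rhs k n p y p′ y′ ⟩
    suc (suc (suc k)) * (y + y′) + suc (suc n) * (p + p′) ∎
    where
    lhs : ∀ k x p x′ p′ y′ → (x + x′) + (y′ + p) + suc (suc k) * (p + p′) ≡
          (x + suc (suc k) * p) + (x′ + suc k * p′) + (y′ + p + p′)
    lhs = solve-∀
    rhs : ∀ k n p y p′ y′ →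
          (suc (suc (suc k)) * y + suc n * p) + (suc (suc k) * y′ + suc n * p′) + (y′ + p + p′) ≡
          suc (suc (suc k)) * (y + y′) + suc (suc n) * (p + p′)
    rhs = solve-∀

-- Sums over the whole cube

cubeSum-∷ : ∀ b (f : Cube (suc n) → ℕ) →
            cubeSum f ≡ cubeSum (f ∘ (b ∷_)) + cubeSum (f ∘ (not b ∷_))
cubeSum-∷ false f = refl
cubeSum-∷ true  f = +-comm (cubeSum (f ∘ (false ∷_))) _

cubeSum-cong : {f g : Cube n → ℕ} → (∀ v → f v ≡ g v) → cubeSum f ≡ cubeSum g
cubeSum-cong {zero}  f≗g = f≗g []
cubeSum-cong {suc n} f≗g =
  cong₂ _+_ (cubeSum-cong (f≗g ∘ (false ∷_))) (cubeSum-cong (f≗g ∘ (true ∷_)))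

cubeSum-+ : ∀ (f g : Cube n → ℕ) → cubeSum (λ v → f v + g v) ≡ cubeSum f + cubeSum g
cubeSum-+ {zero}  f g = refl
cubeSum-+ {suc n} f g = trans
  (cong₂ _+_ (cubeSum-+ (f ∘ (false ∷_)) (g ∘ (false ∷_)))
             (cubeSum-+ (f ∘ (true ∷_)) (g ∘ (true ∷_))))
  (+-interchange (cubeSum (f ∘ (false ∷_))) _ _ _)

cubeSum-* : ∀ (f : Cube n → ℕ) c → cubeSum (λ v → f v * c) ≡ cubeSum f * c
cubeSum-* {zero}  f c = refl
cubeSum-* {suc n} f c = trans
  (cong₂ _+_ (cubeSum-* (f ∘ (false ∷_)) c) (cubeSum-* (f ∘ (true ∷_)) c))
  (sym (*-distribʳ-+ c (cubeSum (f ∘ (false ∷_))) _))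

cubeSum-zero : ∀ n → cubeSum {n} (λ _ → 0) ≡ 0
cubeSum-zero zero    = refl
cubeSum-zero (suc n) = cong₂ _+_ (cubeSum-zero n) (cubeSum-zero n)

f≤cubeSum : ∀ (f : Cube n → ℕ) v → f v ≤ cubeSum f
f≤cubeSum f []      = ≤-refl
f≤cubeSum f (b ∷ v) = ≤-trans (f≤cubeSum (f ∘ (b ∷_)) v)
  (≤-trans (m≤m+n _ _) (≤-reflexive (sym (cubeSum-∷ b f))))

cubeSum-support : ∀ (f : Cube n → ℕ) → cubeSum f ≢ 0 → ∃ λ v → f v ≢ 0
cubeSum-support {zero}  f s≢0 = [] , s≢0
cubeSum-support {suc n} f s≢0 with cubeSum (f ∘ (false ∷_)) ≟ 0
... | no  s₀≢0 = let v , fv≢0 = cubeSum-support _ s₀≢0 in false ∷ v , fv≢0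
... | yes s₀≡0 =
  let v , fv≢0 = cubeSum-support (f ∘ (true ∷_)) (s≢0 ∘ cong₂ _+_ s₀≡0) in true ∷ v , fv≢0

-- The spheres about `v` partition the cube. The bound `d` is kept apart from the dimension because
-- the half through `v` is summed over one radius more than the opposite half.
sphereSum-total : ∀ d (f : Cube n → ℕ) v → n ≤ d →
                  sum {suc d} (λ k → sphereSum (toℕ k) f v) ≡ cubeSum f
sphereSum-total d f [] n≤d =
  trans (cong (f [] +_) (sum-replicate-zero d)) (+-identityʳ _)
sphereSum-total (suc d) f (b ∷ v) (s≤s n≤d) = begin
  f (b ∷ v) + sum {suc d} (λ k → sphereSum (suc (toℕ k)) f₀ v + sphereSum (toℕ k) f₁ v)
    ≡⟨ cong (f (b ∷ v) +_) (∑-distrib-+ {suc d} (λ k → sphereSum (suc (toℕ k)) f₀ v)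
                                                (λ k → sphereSum (toℕ k) f₁ v)) ⟩
  f (b ∷ v) + (sum {suc d} (λ k → sphereSum (suc (toℕ k)) f₀ v) +
               sum {suc d} (λ k → sphereSum (toℕ k) f₁ v))
    ≡⟨ +-assoc (f (b ∷ v)) _ _ ⟨
  sum {suc (suc d)} (λ k → sphereSum (toℕ k) f₀ v) + sum {suc d} (λ k → sphereSum (toℕ k) f₁ v)
    ≡⟨ cong₂ _+_ (sphereSum-total (suc d) f₀ v (m≤n⇒m≤1+n n≤d)) (sphereSum-total d f₁ v n≤d) ⟩
  cubeSum f₀ + cubeSum f₁
    ≡⟨ cubeSum-∷ b f ⟨
  cubeSum f ∎
  where
  open ≡-Reasoning
  f₀ = f ∘ (b ∷_)
  f₁ = f ∘ (not b ∷_)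

-- Both sides sum a value of `f` times a value of `g` over the ordered adjacent pairs. For
-- indicators of classes this counts the edges between two classes from either end.
sphereSum-selfAdjoint : ∀ (f g : Cube n → ℕ) →
  cubeSum (λ v → sphereSum 1 f v * g v) ≡ cubeSum (λ v → f v * sphereSum 1 g v)
sphereSum-selfAdjoint {zero}  f g = sym (*-zeroʳ (f []))
sphereSum-selfAdjoint {suc n} f g = begin
  cubeSum (λ v → (sphereSum 1 f₀ v + f₁ v) * g₀ v) +
  cubeSum (λ v → (sphereSum 1 f₁ v + f₀ v) * g₁ v)
    ≡⟨ cong₂ _+_ (splitˡ f₀ f₁ g₀) (splitˡ f₁ f₀ g₁) ⟩
  (cubeSum (λ v → sphereSum 1 f₀ v * g₀ v) + cubeSum (λ v → f₁ v * g₀ v)) +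
  (cubeSum (λ v → sphereSum 1 f₁ v * g₁ v) + cubeSum (λ v → f₀ v * g₁ v))
    ≡⟨ swap (cubeSum (λ v → sphereSum 1 f₀ v * g₀ v)) _ _ _ ⟩
  (cubeSum (λ v → sphereSum 1 f₀ v * g₀ v) + cubeSum (λ v → f₀ v * g₁ v)) +
  (cubeSum (λ v → sphereSum 1 f₁ v * g₁ v) + cubeSum (λ v → f₁ v * g₀ v))
    ≡⟨ cong₂ _+_ (cong (_+ cubeSum (λ v → f₀ v * g₁ v)) (sphereSum-selfAdjoint f₀ g₀))
                 (cong (_+ cubeSum (λ v → f₁ v * g₀ v)) (sphereSum-selfAdjoint f₁ g₁)) ⟩
  (cubeSum (λ v → f₀ v * sphereSum 1 g₀ v) + cubeSum (λ v → f₀ v * g₁ v)) +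
  (cubeSum (λ v → f₁ v * sphereSum 1 g₁ v) + cubeSum (λ v → f₁ v * g₀ v))
    ≡⟨ cong₂ _+_ (splitʳ f₀ g₀ g₁) (splitʳ f₁ g₁ g₀) ⟨
  cubeSum (λ v → f₀ v * (sphereSum 1 g₀ v + g₁ v)) +
  cubeSum (λ v → f₁ v * (sphereSum 1 g₁ v + g₀ v)) ∎
  where
  open ≡-Reasoning
  f₀ = f ∘ (false ∷_)
  f₁ = f ∘ (true ∷_)
  g₀ = g ∘ (false ∷_)
  g₁ = g ∘ (true ∷_)

  swap : ∀ a b c d → a + b + (c + d) ≡ a + d + (c + b)
  swap = solve-∀

  splitˡ : ∀ (f f′ g : Cube n → ℕ) →
           cubeSum (λ v → (sphereSum 1 f v + f′ v) * g v) ≡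
           cubeSum (λ v → sphereSum 1 f v * g v) + cubeSum (λ v → f′ v * g v)
  splitˡ f f′ g = trans
    (cubeSum-cong (λ v → *-distribʳ-+ (g v) (sphereSum 1 f v) (f′ v)))
    (cubeSum-+ (λ v → sphereSum 1 f v * g v) _)

  splitʳ : ∀ (f g g′ : Cube n → ℕ) →
           cubeSum (λ v → f v * (sphereSum 1 g v + g′ v)) ≡
           cubeSum (λ v → f v * sphereSum 1 g v) + cubeSum (λ v → f v * g′ v)
  splitʳ f g g′ = trans
    (cubeSum-cong (λ v → *-distribˡ-+ (f v) (sphereSum 1 g v) (g′ v)))
    (cubeSum-+ (λ v → f v * sphereSum 1 g v) _)

-- Adjacency in the cube

indicator : {P : Set} → Dec P → ℕ
indicator P? = if does P? then 1 else 0

indicator-true : {P : Set} (P? : Dec P) → P → indicator P? ≡ 1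
indicator-true P? p = cong (if_then 1 else 0) (dec-true P? p)

indicator-false : {P : Set} (P? : Dec P) → ¬ P → indicator P? ≡ 0
indicator-false P? ¬p = cong (if_then 1 else 0) (dec-false P? ¬p)

indicator-⇔ : {P Q : Set} → P ⇔ Q → (P? : Dec P) (Q? : Dec Q) → indicator P? ≡ indicator Q?
indicator-⇔ P⇔Q P? Q? = cong (if_then 1 else 0) (does-⇔ P⇔Q P? Q?)

indicator≢0 : {P : Set} (P? : Dec P) → indicator P? ≢ 0 → P
indicator≢0 (yes p) _   = p
indicator≢0 (no _)  0≢0 = ⊥-elim (0≢0 refl)

indicator≤1 : {P : Set} (P? : Dec P) → indicator P? ≤ 1
indicator≤1 (yes _) = ≤-refl
indicator≤1 (no _)  = z≤n

indicator-× : {P Q : Set} (P? : Dec P) (Q? : Dec Q) →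
              indicator (P? ×-dec Q?) ≡ indicator P? * indicator Q?
indicator-× (yes _) Q? = sym (+-identityʳ _)
indicator-× (no _)  Q? = refl

-- Together with `CubeAdj-flip`, this splits adjacency in the way `sphereSum 1` recurses: a step
-- within the half, or a flip of the first coordinate with the rest fixed.
CubeAdj-∷ : ∀ {b} {v w : Cube n} → CubeAdj (b ∷ v) (b ∷ w) ⇔ CubeAdj v w
CubeAdj-∷ = mk⇔
  (λ { (zero  , d , _) → ⊥-elim (d refl)
     ; (suc i , d , u) → i , d , λ {k} e → suc-injective (u {suc k} e) })
  (λ (i , d , u) → suc i , d , λ { {zero} e → ⊥-elim (e refl) ; {suc k} e → cong suc (u e) })

CubeAdj-flip : ∀ {b} {v w : Cube n} → CubeAdj (b ∷ v) (not b ∷ w) ⇔ v ≡ w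
CubeAdj-flip {n} {b} {v} {w} = mk⇔ tails λ { refl →
  zero , not-¬ refl , λ { {zero} _ → refl ; {suc k} e → ⊥-elim (e refl) } }
  where
  tails : CubeAdj (b ∷ v) (not b ∷ w) → v ≡ w
  -- The first coordinates differ, so the unique differing coordinate cannot be `suc i`.
  tails (suc i , _ , u) with () ← u {zero} (not-¬ refl)
  tails (zero  , _ , u) = trans (sym (tabulate∘lookup v))
    (trans (tabulate-cong agree) (tabulate∘lookup w))
    where
    agree : ∀ k → lookup v k ≡ lookup w k
    agree k with lookup v k ≟ᵇ lookup w k
    ... | yes e = e
    ... | no  d with () ← u {suc k} d

_≟ᶜ_ : (v w : Cube n) → Dec (v ≡ w)
_≟ᶜ_ = ≡-dec _≟ᵇ_

cubeSum-≡ : ∀ (f : Cube n → ℕ) v → cubeSum (λ w → indicator (v ≟ᶜ w) * f w) ≡ f v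
cubeSum-≡ f []      = +-identityʳ _
cubeSum-≡ {suc n} f (b ∷ v) = begin
  cubeSum (λ w → indicator ((b ∷ v) ≟ᶜ w) * f w)
    ≡⟨ cubeSum-∷ b (λ w → indicator ((b ∷ v) ≟ᶜ w) * f w) ⟩
  cubeSum (λ w → indicator ((b ∷ v) ≟ᶜ (b ∷ w)) * f (b ∷ w)) +
  cubeSum (λ w → indicator ((b ∷ v) ≟ᶜ (not b ∷ w)) * f (not b ∷ w))
    ≡⟨ cong₂ _+_
         (cubeSum-cong λ w → cong (_* f (b ∷ w))
            (indicator-⇔ (mk⇔ ∷-injectiveʳ (cong (b ∷_))) ((b ∷ v) ≟ᶜ (b ∷ w)) (v ≟ᶜ w)))
         (cubeSum-cong λ w → cong (_* f (not b ∷ w)) (different w)) ⟩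
  cubeSum (λ w → indicator (v ≟ᶜ w) * f (b ∷ w)) + cubeSum {n} (λ _ → 0)
    ≡⟨ cong₂ _+_ (cubeSum-≡ (f ∘ (b ∷_)) v) (cubeSum-zero n) ⟩
  f (b ∷ v) + 0
    ≡⟨ +-identityʳ _ ⟩
  f (b ∷ v) ∎
  where
  open ≡-Reasoning
  different : ∀ w → indicator ((b ∷ v) ≟ᶜ (not b ∷ w)) ≡ 0
  different w = indicator-false ((b ∷ v) ≟ᶜ (not b ∷ w)) (not-¬ refl ∘ ∷-injectiveˡ)

cubeSum-adjacent : ∀ (f : Cube n → ℕ) v →
                   cubeSum (λ w → indicator (cubeAdj? v w) * f w) ≡ sphereSum 1 f v
cubeSum-adjacent f []      = refl
cubeSum-adjacent f (b ∷ v) = trans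
  (cubeSum-∷ b (λ w → indicator (cubeAdj? (b ∷ v) w) * f w)) (cong₂ _+_
  (trans (cubeSum-cong λ w → cong (_* f (b ∷ w))
            (indicator-⇔ CubeAdj-∷ (cubeAdj? (b ∷ v) (b ∷ w)) (cubeAdj? v w)))
         (cubeSum-adjacent (f ∘ (b ∷_)) v))
  (trans (cubeSum-cong λ w → cong (_* f (not b ∷ w))
            (indicator-⇔ CubeAdj-flip (cubeAdj? (b ∷ v) (not b ∷ w)) (v ≟ᶜ w)))
         (cubeSum-≡ (f ∘ (not b ∷_)) v)))

length-filter-++ : {X : Set} {P : X → Set} (P? : Decidable P) (xs ys : List X) →
  length (filter P? (xs ++ ys)) ≡ length (filter P? xs) + length (filter P? ys)
length-filter-++ P? xs ys = trans (cong length (filter-++ P? xs ys)) (length-++ (filter P? xs))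

length-filter-map : {X Y : Set} {P : Y → Set} (P? : Decidable P) (f : X → Y) (xs : List X) →
  length (filter P? (map f xs)) ≡ length (filter (P? ∘ f) xs)
length-filter-map P? f []       = refl
length-filter-map P? f (x ∷ xs) with does (P? (f x))
... | true  = cong suc (length-filter-map P? f xs)
... | false = length-filter-map P? f xs

length-filter-cube : {P : Cube n → Set} (P? : Decidable P) →
  length (filter P? (cubeVertices n)) ≡ cubeSum (indicator ∘ P?)
length-filter-cube {zero}  P? with does (P? [])
... | true  = refl
... | false = refl
length-filter-cube {suc n} P? = trans
  (length-filter-++ P? (map (false ∷_) (cubeVertices n)) _)
  (cong₂ _+_
    (trans (length-filter-map P? (false ∷_) (cubeVertices n))
           (length-filter-cube (P? ∘ (false ∷_))))
    (trans (length-filter-map P? (true ∷_) (cubeVertices n))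
           (length-filter-cube (P? ∘ (true ∷_)))))

-- The bridge from the filtered vertex list in the definition of perfectness to recursive sums; it
-- serves both the necessary conditions and the verification of examples.
neighboursOfColour-sphereSum : ∀ (c : Colouring (Q n) m) v j → let open Colouring c in
  neighboursOfColour v j ≡ sphereSum 1 (λ w → indicator (colour w ≟ᶠ j)) v
neighboursOfColour-sphereSum c v j = trans
  (length-filter-cube (λ w → cubeAdj? v w ×-dec (colour w ≟ᶠ j)))
  (trans (cubeSum-cong λ w → indicator-× (cubeAdj? v w) (colour w ≟ᶠ j))
         (cubeSum-adjacent _ v))
  where open Colouring c

adjacent-≤ : ∀ (f : Cube n → ℕ) v w → CubeAdj v w → f w ≤ sphereSum 1 f v
adjacent-≤ f v w v~w = begin
  f w
    ≡⟨ *-identityˡ (f w) ⟨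
  1 * f w
    ≡⟨ cong (_* f w) (indicator-true (cubeAdj? v w) v~w) ⟨
  indicator (cubeAdj? v w) * f w
    ≤⟨ f≤cubeSum (λ w → indicator (cubeAdj? v w) * f w) w ⟩
  cubeSum (λ w → indicator (cubeAdj? v w) * f w)
    ≡⟨ cubeSum-adjacent f v ⟩
  sphereSum 1 f v ∎
  where open ≤-Reasoning

sphereSum-adjacent : ∀ (f : Cube n → ℕ) v → sphereSum 1 f v ≢ 0 →
                     ∃ λ w → CubeAdj v w × f w ≢ 0
sphereSum-adjacent f v s≢0 =
  let w , p = cubeSum-support (λ w → indicator (cubeAdj? v w) * f w)
                              (s≢0 ∘ trans (sym (cubeSum-adjacent f v)))
  in w , indicator≢0 (cubeAdj? v w) (λ e → p (cong (_* f w) e))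
       , λ e → p (trans (cong (indicator (cubeAdj? v w) *_) e) (*-zeroʳ (indicator (cubeAdj? v w))))

sphereSum-mono : ∀ {f g : Cube n → ℕ} → (∀ v → f v ≤ g v) →
                 ∀ v → sphereSum 1 f v ≤ sphereSum 1 g v
sphereSum-mono f≤g []      = z≤n
sphereSum-mono f≤g (b ∷ v) = +-mono-≤ (sphereSum-mono (f≤g ∘ (b ∷_)) v) (f≤g (not b ∷ v))

-- Each of the n-1 edges parallel to vw whose ends are neighbours of v and w
-- contributes at most 1.
edge-bound : ∀ (f : Cube n → ℕ) → (∀ {x y} → CubeAdj x y → f x + f y ≤ 1) →
             ∀ {v w} → CubeAdj v w →
             suc (sphereSum 1 f v + sphereSum 1 f w) ≤ n + (f v + f w)
edge-bound {suc n} f indep {b ∷ v} {b′ ∷ w} v~w with b ≟ᵇ b′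
-- The edge lies in a half of the cube: its translate across the first coordinate contributes at
-- most 1, and the other directions are covered by induction.
... | yes refl = begin
  suc (sphereSum 1 f₀ v + f (not b ∷ v) + (sphereSum 1 f₀ w + f (not b ∷ w)))
    ≡⟨ cong suc (+-interchange (sphereSum 1 f₀ v) _ _ _) ⟩
  suc (sphereSum 1 f₀ v + sphereSum 1 f₀ w + (f (not b ∷ v) + f (not b ∷ w)))
    ≤⟨ +-mono-≤ (edge-bound f₀ (indep ∘ from CubeAdj-∷) v~w′) (indep (from CubeAdj-∷ v~w′)) ⟩
  n + (f (b ∷ v) + f (b ∷ w)) + 1
    ≡⟨ +-comm _ 1 ⟩
  suc n + (f (b ∷ v) + f (b ∷ w)) ∎
  where
  open ≤-Reasoning
  f₀ = f ∘ (b ∷_)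
  v~w′ = to CubeAdj-∷ v~w
-- The edge runs in the first direction, so its translates join the neighbours of `v` within one
-- half to their flips. There are `n` of them, and `f₀ + f₁` is at most 1 on each.
... | no b≢b′ with refl ← ¬-not (b≢b′ ∘ sym)
  with refl ← to CubeAdj-flip v~w
  rewrite not-involutive b = begin
  suc (sphereSum 1 f₀ v + f (not b ∷ v) + (sphereSum 1 f₁ v + f (b ∷ v)))
    ≡⟨ cong suc (rearrange (sphereSum 1 f₀ v) _ _ _) ⟩
  suc (sphereSum 1 f₀ v + sphereSum 1 f₁ v + (f (b ∷ v) + f (not b ∷ v)))
    ≡⟨ cong (λ s → suc (s + (f (b ∷ v) + f (not b ∷ v)))) (sphereSum-+ 1 f₀ f₁ v) ⟨
  suc (sphereSum 1 (λ x → f₀ x + f₁ x) v + (f (b ∷ v) + f (not b ∷ v)))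
    ≤⟨ s≤s (+-monoˡ-≤ _ (sphereSum-mono (λ x → indep (from CubeAdj-flip refl)) v)) ⟩
  suc (sphereSum 1 (λ _ → 1) v + (f (b ∷ v) + f (not b ∷ v)))
    ≡⟨ cong (λ s → suc (s + (f (b ∷ v) + f (not b ∷ v)))) (sphereSum-one v) ⟩
  suc n + (f (b ∷ v) + f (not b ∷ v)) ∎
  where
  open ≤-Reasoning
  f₀ = f ∘ (b ∷_)
  f₁ = f ∘ (not b ∷_)
  rearrange : ∀ x p y q → x + p + (y + q) ≡ x + y + (q + p)
  rearrange = solve-∀

-- Necessary conditions on colour adjacency matrices

sum-indicator : ∀ (g : Fin m → ℕ) x → sum (λ l → indicator (x ≟ᶠ l) * g l) ≡ g x
sum-indicator {suc m} g zero    =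
  trans (cong₂ _+_ (+-identityʳ (g zero)) (sum-replicate-zero m)) (+-identityʳ (g zero))
sum-indicator {suc m} g (suc x) = sum-indicator (g ∘ suc) x

indicator-subst : ∀ (g : Fin m → ℕ) x i → indicator (x ≟ᶠ i) * g x ≡ indicator (x ≟ᶠ i) * g i
indicator-subst g x i with x ≟ᶠ i
... | yes refl = refl
... | no  _    = refl

matrix : (Fin m → Fin m → ℕ) → Matrix m
matrix f = tabulate λ i → tabulate (f i)

-- Junk (∸ and / round) unless the numerator is a nonnegative multiple of k+2, which is
-- what Recurrence demands.
step : ∀ n (A : Matrix m) → ℕ → Matrix m × Matrix m → Matrix m × Matrix m
step n A k (P , Q) = Q , matrix λ i j →
  (sum (λ l → entry A i l * entry Q l j) + suc k * entry P i j ∸ suc n * entry P i j) / suc (suc k)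

-- The `k`-th value is the pair of Dₖ and Dₖ₊₁, since the recurrence has depth two.
distances : ∀ n (A : Matrix m) → ℕ → Matrix m × Matrix m
distances n A zero    = matrix (λ i j → indicator (i ≟ᶠ j)) , A
distances n A (suc k) = step n A k (distances n A k)

distance : ∀ n (A : Matrix m) → ℕ → Matrix m
distance n A k = proj₁ (distances n A k)

Recurrence : ∀ n (A : Matrix m) → ℕ → Matrix m × Matrix m → Set
Recurrence n A k (P , Q) = ∀ i j →
   sum (λ l → entry A i l * entry Q l j) + suc k * entry P i j ≡
   suc (suc k) * entry (proj₂ (step n A k (P , Q))) i j + suc n * entry P i j

-- Taking the Dₖ as a vector makes evaluation compute each of them only once.
ballSizes : Vec (Matrix m) n → Matrix m
ballSizes Ds = matrix λ i j → sum λ k → entry (lookup Ds k) i j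

-- The radii 0 to `n` exhaust the cube, so for a colouring row `l` lists the class sizes as counted
-- from a vertex of colour `l`.
classSizes : ∀ n (A : Matrix m) → Matrix m
classSizes n A = ballSizes (tabulate {n = suc n} (distance n A ∘ toℕ))

Positive : Matrix m → Set
Positive S = ∀ l i → 0 < entry S l i

Balanced : Matrix m → Matrix m → Set
Balanced A S = ∀ l i j → entry S l i * entry A i j ≡ entry S l j * entry A j i

entry-matrix : ∀ (f : Fin m → Fin m → ℕ) i j → entry (matrix f) i j ≡ f i j
entry-matrix f i j =
  trans (cong (λ r → lookup r j) (lookup∘tabulate _ i)) (lookup∘tabulate (f i) j)

-- Conditions on `A` alone, with no colouring involved, so that evaluation can decide them. The
-- recurrence is imposed up to Dₙ₊₁, one radius beyond the cube.
record Feasible (n : ℕ) (A : Matrix m) : Set where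
  constructor feasible
  field
    recurrence  : ∀ (k : Fin n) → Recurrence n A (toℕ k) (distances n A (toℕ k))
    positive    : Positive (classSizes n A)
    balanced    : Balanced A (classSizes n A)
    independent : ∀ i j → entry A i i ≡ 0 → entry A j j ≢ 0 → 2 * entry A j i < n

feasible? : ∀ n (A : Matrix m) → Dec (Feasible n A)
feasible? n A = map′
  (λ (r , p , b , d) → feasible r p b d)
  (λ (feasible r p b d) → r , p , b , d)
  ((all? λ k → rec? (toℕ k) (distances n A (toℕ k)))
    ×-dec pos? (classSizes n A)
    ×-dec bal? (classSizes n A)
    ×-dec (all? λ i → all? λ j →
      entry A i i ≟ 0 →-dec (¬? (entry A j j ≟ 0) →-dec 2 * entry A j i <? n)))
  where
  -- The helpers take the computed matrices as arguments so that evaluation shares them between the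
  -- entries.
  rec? : ∀ k PQ → Dec (Recurrence n A k PQ)
  rec? k (P , Q) = all? λ i → all? λ j → _ ≟ _

  pos? : ∀ S → Dec (Positive S)
  pos? S = all? λ l → all? λ i → 0 <? _

  bal? : ∀ S → Dec (Balanced A S)
  bal? S = all? λ l → all? λ i → all? λ j → _ ≟ _

-- Perfect colourings satisfy the conditions

module _ (c : Colouring (Q n) m) (A : Matrix m) (perfect : PerfectWithMatrix c A) where
  open Colouring c

  class : Fin m → Cube n → ℕ
  class i v = indicator (colour v ≟ᶠ i)

  sphereSum-class : ∀ v j → sphereSum 1 (class j) v ≡ entry A (colour v) j
  sphereSum-class v j =
    trans (sym (neighboursOfColour-sphereSum c v j)) (perfect (colour v) j v refl)

  -- On functions of the colour, summing over neighbours acts as the matrix `A`: such a function is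
  -- a linear combination of class indicators.
  sphereSum-colour : ∀ (g : Fin m → ℕ) v →
                     sphereSum 1 (g ∘ colour) v ≡ sum λ l → entry A (colour v) l * g l
  sphereSum-colour g v = begin
    sphereSum 1 (g ∘ colour) v
      ≡⟨ sphereSum-cong 1 (λ w → sym (sum-indicator g (colour w))) v ⟩
    sphereSum 1 (λ w → sum λ l → class l w * g l) v
      ≡⟨ sphereSum-∑ 1 (λ l w → class l w * g l) v ⟩
    (sum λ l → sphereSum 1 (λ w → class l w * g l) v)
      ≡⟨ sum-cong-≗ (λ l → trans (sphereSum-* 1 (class l) (g l) v)
                                 (cong (_* g l) (sphereSum-class v l))) ⟩
    (sum λ l → entry A (colour v) l * g l) ∎
    where open ≡-Reasoning

  row-sum : ∀ i → sum (lookup (lookup A i)) ≡ n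
  row-sum i with v , refl ← nonempty i = begin
    sum (lookup (lookup A i))          ≡⟨ sum-cong-≗ (λ l → sym (*-identityʳ (entry A i l))) ⟩
    (sum λ l → entry A i l * 1)        ≡⟨ sphereSum-colour (λ _ → 1) v ⟨
    sphereSum 1 (λ _ → 1) v            ≡⟨ sphereSum-one v ⟩
    n                                  ∎
    where open ≡-Reasoning

  Counts : ℕ → Matrix m → Set
  Counts k D = ∀ v j → sphereSum k (class j) v ≡ entry D (colour v) j

  -- By `hQ` the counts at radius `suc k` depend only on the colour, so summing them over neighbours
  -- multiplies by `A`; the rest is the recurrence for spheres.
  counts-recurrence : ∀ k P Q → Counts k P → Counts (suc k) Q → ∀ v j →
    sum (λ l → entry A (colour v) l * entry Q l j) + suc k * entry P (colour v) j ≡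
    suc (suc k) * sphereSum (suc (suc k)) (class j) v + suc n * entry P (colour v) j
  counts-recurrence k P Q hP hQ v j = begin
    sum (λ l → entry A (colour v) l * entry Q l j) + suc k * entry P (colour v) j
      ≡⟨ cong (_+ _) (sphereSum-colour (λ l → entry Q l j) v) ⟨
    sphereSum 1 (λ w → entry Q (colour w) j) v + suc k * entry P (colour v) j
      ≡⟨ cong₂ (λ s p → s + suc k * p) (sphereSum-cong 1 (λ w → hQ w j) v) (hP v j) ⟨
    sphereSum 1 (sphereSum (suc k) (class j)) v + suc k * sphereSum k (class j) v
      ≡⟨ sphereSum-recurrence k (class j) v ⟩
    suc (suc k) * sphereSum (suc (suc k)) (class j) v + suc n * sphereSum k (class j) v
      ≡⟨ cong (λ p → suc (suc k) * sphereSum (suc (suc k)) (class j) v + suc n * p) (hP v j) ⟩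
    suc (suc k) * sphereSum (suc (suc k)) (class j) v + suc n * entry P (colour v) j ∎
    where open ≡-Reasoning

  -- The true count at distance `k + 2` is an exact quotient, so truncated subtraction and division
  -- return it.
  counts-step : ∀ k P Q → Counts k P → Counts (suc k) Q →
                Counts (suc (suc k)) (proj₂ (step n A k (P , Q)))
  counts-step k P Q hP hQ v j = sym (trans
    (entry-matrix _ (colour v) j)
    (divide {suc k} (sphereSum (suc (suc k)) (class j) v) (suc n * entry P (colour v) j)
            (counts-recurrence k P Q hP hQ v j)))
    where
    divide : ∀ {d a} x b → a ≡ suc d * x + b → (a ∸ b) / suc d ≡ x
    divide {d} x b refl = trans
      (cong (_/ suc d) (trans (m+n∸n≡m (suc d * x) b) (*-comm (suc d) x)))
      (m*n/n≡m x (suc d))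

  counts : ∀ k → Counts k (proj₁ (distances n A k)) × Counts (suc k) (proj₂ (distances n A k))
  counts zero    = (λ v j → sym (entry-matrix _ (colour v) j)) , sphereSum-class
  counts (suc k) =
    let P , Q = distances n A k
        hP , hQ = counts k
    in hQ , counts-step k P Q hP hQ

  recurrence-holds : ∀ k → Recurrence n A k (distances n A k)
  recurrence-holds k i j
    with v , refl ← nonempty i
    with hP , hQ ← counts k
    = trans
      (counts-recurrence k (proj₁ (distances n A k)) (proj₂ (distances n A k)) hP hQ v j)
      (cong (λ s → suc (suc k) * s + suc n * entry (proj₁ (distances n A k)) i j)
            (counts-step k (proj₁ (distances n A k)) (proj₂ (distances n A k)) hP hQ v j))

  classSizes-correct : ∀ l i → entry (classSizes n A) l i ≡ cubeSum (class i)
  classSizes-correct l i with v , refl ← nonempty l = begin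
    entry (classSizes n A) l i
      ≡⟨ entry-matrix _ l i ⟩
    (sum {suc n} λ k → entry (lookup (tabulate (distance n A ∘ toℕ)) k) l i)
      ≡⟨ sum-cong-≗ {suc n} (λ k → trans
           (cong (λ D → entry D l i) (lookup∘tabulate (distance n A ∘ toℕ) k))
           (sym (proj₁ (counts (toℕ k)) v i))) ⟩
    (sum {suc n} λ k → sphereSum (toℕ k) (class i) v)
      ≡⟨ sphereSum-total n (class i) v ≤-refl ⟩
    cubeSum (class i) ∎
    where open ≡-Reasoning

  classSizes-positive : Positive (classSizes n A)
  classSizes-positive l i with v , refl ← nonempty i = begin-strict
    0                            <⟨ s≤s z≤n ⟩
    1                            ≡⟨ indicator-true (colour v ≟ᶠ i) refl ⟨
    class i v                    ≤⟨ f≤cubeSum (class i) v ⟩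
    cubeSum (class i)            ≡⟨ classSizes-correct l i ⟨
    entry (classSizes n A) l i   ∎
    where open ≤-Reasoning

  edges-between : ∀ i j → cubeSum (λ v → class i v * sphereSum 1 (class j) v) ≡
                          cubeSum (class i) * entry A i j
  edges-between i j = trans
    (cubeSum-cong λ v → trans (cong (class i v *_) (sphereSum-class v j))
                              (indicator-subst (λ x → entry A x j) (colour v) i))
    (cubeSum-* (class i) (entry A i j))

  classSizes-balanced : Balanced A (classSizes n A)
  classSizes-balanced l i j = begin
    entry (classSizes n A) l i * entry A i j
      ≡⟨ cong (_* entry A i j) (classSizes-correct l i) ⟩
    cubeSum (class i) * entry A i j
      ≡⟨ edges-between i j ⟨
    cubeSum (λ v → class i v * sphereSum 1 (class j) v)
      ≡⟨ sphereSum-selfAdjoint (class i) (class j) ⟨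
    cubeSum (λ v → sphereSum 1 (class i) v * class j v)
      ≡⟨ cubeSum-cong (λ v → *-comm (sphereSum 1 (class i) v) (class j v)) ⟩
    cubeSum (λ v → class j v * sphereSum 1 (class i) v)
      ≡⟨ edges-between j i ⟩
    cubeSum (class j) * entry A j i
      ≡⟨ cong (_* entry A j i) (classSizes-correct l j) ⟨
    entry (classSizes n A) l j * entry A j i ∎
    where open ≡-Reasoning

  independent-class : ∀ i → entry A i i ≡ 0 → ∀ {x y} → CubeAdj x y → class i x + class i y ≤ 1
  independent-class i aᵢᵢ≡0 {x} {y} x~y with colour x ≟ᶠ i
  ... | no  _    = indicator≤1 (colour y ≟ᶠ i)
  ... | yes refl = s≤s (begin
    class i y                  ≤⟨ adjacent-≤ (class i) x y x~y ⟩
    sphereSum 1 (class i) x    ≡⟨ sphereSum-class x i ⟩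
    entry A i i                ≡⟨ aᵢᵢ≡0 ⟩
    0                          ∎)
    where open ≤-Reasoning

  -- As `entry A j j` is nonzero, some edge lies within class `j`; `edge-bound` is applied to it
  -- with the indicator of class `i`. The two diagonal entries differ, hence so do the colours, and
  -- the ends of the edge contribute nothing.
  independent-bound : ∀ i j → entry A i i ≡ 0 → entry A j j ≢ 0 → 2 * entry A j i < n
  independent-bound i j aᵢᵢ≡0 aⱼⱼ≢0
    with v , refl ← nonempty j
    with w , v~w , w∈j ← sphereSum-adjacent (class j) v (aⱼⱼ≢0 ∘ trans (sym (sphereSum-class v j)))
    = begin
    suc (2 * entry A j i)
      ≡⟨ cong (λ a → suc (entry A j i + a)) (+-identityʳ _) ⟩
    suc (entry A j i + entry A j i)
      ≡⟨ cong₂ (λ a b → suc (a + b)) (sphereSum-class v i)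
           (trans (sphereSum-class w i) (cong (λ x → entry A x i) w-colour)) ⟨
    suc (sphereSum 1 (class i) v + sphereSum 1 (class i) w)
      ≤⟨ edge-bound (class i) (independent-class i aᵢᵢ≡0) v~w ⟩
    n + (class i v + class i w)
      ≡⟨ cong₂ (λ a b → n + (a + b)) (not-i v refl) (not-i w w-colour) ⟩
    n + 0
      ≡⟨ +-identityʳ n ⟩
    n ∎
    where
    open ≤-Reasoning
    w-colour : colour w ≡ j
    w-colour = indicator≢0 (colour w ≟ᶠ j) w∈j

    not-i : ∀ x → colour x ≡ j → class i x ≡ 0
    not-i x x∈j = indicator-false (colour x ≟ᶠ i) λ x∈i →
      aⱼⱼ≢0 (subst (λ k → entry A k k ≡ 0) (trans (sym x∈i) x∈j) aᵢᵢ≡0)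

  perfect⇒feasible : Feasible n A
  perfect⇒feasible = feasible (λ k → recurrence-holds (toℕ k))
    classSizes-positive classSizes-balanced independent-bound

-- Enumeration of the candidate matrices

permutations : ∀ m → List (Permutation′ m)
permutations zero    = [ Perm.id ]
permutations (suc m) = cartesianProductWith (insert zero) (allFin (suc m)) (permutations m)

insert-cong : ∀ (j : Fin (suc m)) {π ρ : Permutation′ m} → π ≈ ρ → insert zero j π ≈ insert zero j ρ
insert-cong j π≈ρ zero    = refl
insert-cong j π≈ρ (suc k) = cong (punchIn j) (π≈ρ k)

-- Pointwise equality is enough, as `∼` only uses the values of a permutation. Each permutation is
-- recovered from the image of `zero` and the permutation left after removing `zero`.
permutations-complete : ∀ (π : Permutation′ m) → Any (π ≈_) (permutations m)
permutations-complete {zero}  π = here λ ()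
permutations-complete {suc m} π =
  cartesianProductWith⁺ (insert zero)
    (λ { refl π′≈ρ i → trans (sym (Perm.insert-remove zero π i))
                             (insert-cong _ {remove zero π} π′≈ρ i) })
    (∈-allFin (π ⟨$⟩ʳ zero)) (permutations-complete (remove zero π))

_∼?_ : ∀ (A B : Matrix m) → Dec (A ∼ B)
A ∼? B = map′ Any.satisfied
  (λ (σ , e) → Any.map (λ σ≈ρ i j → trans (e i j) (cong₂ (entry A) (σ≈ρ i) (σ≈ρ j)))
                       (permutations-complete σ))
  (Any.any? (λ σ → all? λ i → all? λ j → entry B i j ≟ entry A (σ ⟨$⟩ʳ i) (σ ⟨$⟩ʳ j))
            (permutations _))

vectors : {X : Set} → List X → ∀ m → List (Vec X m)
vectors xs zero    = [ [] ]
vectors xs (suc m) = cartesianProductWith _∷_ xs (vectors xs m)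

rows : ℕ → ∀ m → List (Vec ℕ m)
rows n m = filter (λ r → sum (lookup r) ≟ n) (vectors (upTo (suc n)) m)

vectors-complete : {X : Set} {xs : List X} (v : Vec X m) →
                   (∀ i → lookup v i ∈ xs) → v ∈ vectors xs m
vectors-complete []      _ = here refl
vectors-complete (x ∷ v) h =
  ∈-cartesianProductWith⁺ _∷_ (h zero) (vectors-complete v (h ∘ suc))

entry≤sum : ∀ (g : Fin m → ℕ) i → g i ≤ sum g
entry≤sum g zero    = m≤m+n _ _
entry≤sum g (suc i) = ≤-trans (entry≤sum (g ∘ suc) i) (m≤n+m _ _)

rows-complete : ∀ (r : Vec ℕ m) → sum (lookup r) ≡ n → r ∈ rows n m
rows-complete r refl = ∈-filter⁺ (λ r → sum (lookup r) ≟ _)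
  (vectors-complete r λ i → ∈-upTo⁺ (s≤s (entry≤sum (lookup r) i))) refl

-- A finite check: for `n = 5` the row sums leave 36 candidates with two colours and 9261 with
-- three.
Classified : ∀ n → List (Matrix m) → Set
Classified {m} n Bs = All (λ A → Feasible n A → Any (A ∼_) Bs) (vectors (rows n m) m)

classified? : ∀ n (Bs : List (Matrix m)) → Dec (Classified n Bs)
classified? n Bs = All.all? (λ A → feasible? n A →-dec Any.any? (A ∼?_) Bs) _

classify : {Bs : List (Matrix m)} → Classified n Bs →
           ∀ A → IsColourAdjacencyMatrix (Q n) A → Any (A ∼_) Bs
classify cl A (c , perfect) = All.lookup cl
  (vectors-complete A λ i → rows-complete (lookup A i) (row-sum c A perfect i))
  (perfect⇒feasible c A perfect)

-- Realisations

-- Colour `i` is renamed to `σ ⟨$⟩ʳ i`, so neighbours of new colour `j` are those of old colour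
-- `σ ⟨$⟩ˡ j`.
∼-realised : ∀ {G} (A B : Matrix m) → A ∼ B →
             IsColourAdjacencyMatrix G B → IsColourAdjacencyMatrix G A
∼-realised {G = G} A B (σ , B≡A∘σ) (c , perfect) = record
  { colour   = (σ ⟨$⟩ʳ_) ∘ colour
  ; nonempty = λ j → let v , e = nonempty (σ ⟨$⟩ˡ j) in
      v , trans (cong (σ ⟨$⟩ʳ_) e) (Perm.inverseʳ σ)
  } , λ { _ j v refl → begin
    length (filter (λ w → adj? v w ×-dec (σ ⟨$⟩ʳ colour w ≟ᶠ j)) vertices)
      ≡⟨ cong length (filter-≐
           (λ w → adj? v w ×-dec (σ ⟨$⟩ʳ colour w ≟ᶠ j))
           (λ w → adj? v w ×-dec (colour w ≟ᶠ σ ⟨$⟩ˡ j))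
           ( (λ (a , e) → a , trans (sym (Perm.inverseˡ σ)) (cong (σ ⟨$⟩ˡ_) e))
           , (λ (a , e) → a , trans (cong (σ ⟨$⟩ʳ_) e) (Perm.inverseʳ σ)))
           vertices) ⟩
    neighboursOfColour v (σ ⟨$⟩ˡ j)
      ≡⟨ perfect _ _ v refl ⟩
    entry B (colour v) (σ ⟨$⟩ˡ j)
      ≡⟨ B≡A∘σ _ _ ⟩
    entry A (σ ⟨$⟩ʳ colour v) (σ ⟨$⟩ʳ (σ ⟨$⟩ˡ j))
      ≡⟨ cong (entry A _) (Perm.inverseʳ σ) ⟩
    entry A (σ ⟨$⟩ʳ colour v) j ∎ }
  where
  open FiniteGraph G
  open Colouring c
  open ≡-Reasoning

-- A form of perfectness suited to evaluation: vertices are taken from the list, and neighbours are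
-- summed by recursion instead of testing all pairs for adjacency.
Realises : (Cube n → Fin m) → Matrix m → Set
Realises {n} f A =
  (∀ j → Any (λ v → f v ≡ j) (cubeVertices n)) ×
  All (λ v → ∀ j → sphereSum 1 (λ w → indicator (f w ≟ᶠ j)) v ≡ entry A (f v) j) (cubeVertices n)

realises? : ∀ (f : Cube n → Fin m) A → Dec (Realises f A)
realises? f A =
  (all? λ j → Any.any? (λ v → f v ≟ᶠ j) _) ×-dec All.all? (λ v → all? λ j → _ ≟ _) _

-- Only the Boolean has to be evaluated for `refl` to type-check, not the proof behind it.
decided : {P : Set} (P? : Dec P) → does P? ≡ true → P
decided (yes p) refl = p

Realisable : ∀ n → Matrix m → Set
Realisable {m} n A = ∃ λ (f : Cube n → Fin m) → does (realises? f A) ≡ true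

realised : ∀ (A : Matrix m) → Realisable n A → IsColourAdjacencyMatrix (Q n) A
realised A (f , eq) =
  let surjective , perfect = decided (realises? f A) eq
      c = record { colour = f ; nonempty = Any.satisfied ∘ surjective }
  in c , λ { _ j v refl → trans (neighboursOfColour-sphereSum c v j)
                                (All.lookup perfect (cubeVertices-complete v) j) }

bit : Bool → Fin 2
bit p = if p then 1F else 0F

split : Bool → Bool → Fin 3
split p q = if p then 2F else if q then 1F else 0F

-- The distance to the pair of constant vertices, which is the smaller of the weight and 5 minus the
-- weight.
antipodalDistance : Cube 5 → Fin 3
antipodalDistance v with count (_≟ᵇ true) v
... | 0 = 0F
... | 1 = 1F
... | 4 = 1F
... | 5 = 0F
... | _ = 2F

realised₂ : All (IsColourAdjacencyMatrix (Q 5)) matrices₂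
realised₂ = All.map (λ {A} → realised A) (
    -- A linear form in `w` variables changes along exactly `w` of the five directions, so its
    -- matrix has `w` off the diagonal.
    ((λ { (a ∷ b ∷ c ∷ d ∷ e ∷ []) → bit (a xor b xor c xor d xor e) }) , refl)
  ∷ ((λ { (a ∷ b ∷ c ∷ d ∷ _ ∷ []) → bit (a xor b xor c xor d) }) , refl)
  -- Colour 0 means `a = b = c`. Elsewhere exactly one of the three is in the minority, and only
  -- flipping it leads to colour 0.
  ∷ ((λ { (a ∷ b ∷ c ∷ _ ∷ _ ∷ []) → bit ((a xor b) ∨ (b xor c)) }) , refl)
  ∷ ((λ { (a ∷ b ∷ c ∷ _ ∷ _ ∷ []) → bit (a xor b xor c) }) , refl)
  ∷ ((λ { (a ∷ b ∷ _ ∷ _ ∷ _ ∷ []) → bit (a xor b) }) , refl)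
  ∷ ((λ { (a ∷ _ ∷ _ ∷ _ ∷ _ ∷ []) → bit a }) , refl)
  ∷ [])

realised₃ : All (IsColourAdjacencyMatrix (Q 5)) matrices₃
realised₃ = All.map (λ {A} → realised A) (
    -- When both arguments of `split` are linear, the second contains exactly half of the variables
    -- of the first. Hence colour 2 is left equally often towards colours 0 and 1, and variables of
    -- the second form alone swap these two.
    ((λ { (a ∷ b ∷ c ∷ d ∷ e ∷ []) → split (a xor b xor c xor d) (a xor b xor e) }) , refl)
  ∷ ((λ { (a ∷ b ∷ c ∷ d ∷ e ∷ []) → split (a xor b) (a xor c xor d xor e) }) , refl)
  ∷ (antipodalDistance , refl)
  -- Colour 0 means `a = b = c = d`. At odd weight one of the four is in the minority: flipping it
  -- gives colour 0, flipping any of the other three gives colour 1.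
  ∷ ((λ { (a ∷ b ∷ c ∷ d ∷ _ ∷ []) →
      split (a xor b xor c xor d) ((a xor b) ∨ (b xor c) ∨ (c xor d)) }) , refl)
  ∷ ((λ { (a ∷ b ∷ c ∷ d ∷ _ ∷ []) → split (a xor b xor c xor d) (a xor b) }) , refl)
  ∷ ((λ { (a ∷ b ∷ c ∷ d ∷ _ ∷ []) → split (a xor b) (a xor c xor d) }) , refl)
  ∷ ((λ { (a ∷ b ∷ c ∷ _ ∷ _ ∷ []) → split (a xor b) (a xor c) }) , refl)
  ∷ ((λ { (a ∷ b ∷ _ ∷ _ ∷ _ ∷ []) → split (a xor b) a }) , refl)
  ∷ [])

-- Assembling the classification

colourAdjacencyMatrices : {Bs : List (Matrix m)} → Classified n Bs →
  All (IsColourAdjacencyMatrix (Q n)) Bs →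
  ∀ A → IsColourAdjacencyMatrix (Q n) A ⇔ Any (A ∼_) Bs
colourAdjacencyMatrices {n = n} {Bs = Bs} cl rs A = mk⇔ (classify cl A) realise
  where
  realise : Any (A ∼_) Bs → IsColourAdjacencyMatrix (Q n) A
  realise A∼Bs = let B-realised , A∼B = All.lookupAny {Q = A ∼_} rs A∼Bs
                 in ∼-realised A (Any.lookup A∼Bs) A∼B B-realised

-- Needed for the counts six and eight: no listed matrix is a relabelling of another.
inequivalent? : ∀ (Bs : List (Matrix m)) → Dec (AllPairs (λ A B → ¬ (A ∼ B)) Bs)
inequivalent? = AllPairs.allPairs? (λ A B → ¬? (A ∼? B))

theorem6p1 : ( (∀ (A : Matrix 2) → IsColourAdjacencyMatrix (Q 5) A ⇔ Any (A ∼_) matrices₂)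
    × AllPairs (λ A B → ¬ (A ∼ B)) matrices₂
    × All (IsColourAdjacencyMatrix (Q 5)) matrices₂ )
    ×
    ( (∀ (A : Matrix 3) → IsColourAdjacencyMatrix (Q 5) A ⇔ Any (A ∼_) matrices₃)
    × AllPairs (λ A B → ¬ (A ∼ B)) matrices₃
    × All (IsColourAdjacencyMatrix (Q 5)) matrices₃ )
theorem6p1 =
  -- The case analysis is carried out by evaluation behind `refl`: every feasible candidate is
  -- matched with a listed matrix.
  ( colourAdjacencyMatrices (decided (classified? 5 matrices₂) refl) realised₂
  , decided (inequivalent? matrices₂) refl
  , realised₂ ) ,
  ( colourAdjacencyMatrices (decided (classified? 5 matrices₃) refl) realised₃
  , decided (inequivalent? matrices₃) refl
  , realised₃ )
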